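{- All the logical rules $0,+,\times,\sqcup,\sqcap,\Diamond$ of $\mathbf{HMR}$ are CAN-free invertible in $\mathbf{HMR}$: for every instance of one of these rules, if its conclusion has a CAN-free derivation in $\mathbf{HMR}$, then each of its premises has a CAN-free derivation in $\mathbf{HMR}$.
   Context: Terms. Fix a countable set of variables $x,y,\dots$. Terms (in negation normal form) are generated by $A ::= x \mid \overline{x} \mid 0 \mid 1 \mid \overline{1} \mid A+A \mid rA \mid A\sqcup A \mid A\sqcap A \mid \Diamond A$ with $r\in\mathbb{R}_{>0}$. Negation: $\overline{x}$ for $x$, $\overline{\overline{x}}=x$, $\overline{0}=0$, $\overline 1$ for $1$, $\overline{\overline{1}}=1$, $\overline{A+B}=\overline A+\overline B$, $\overline{rA}=r\overline A$, $\overline{A\sqcup B}=\overline A\sqcap\overline B$, $\overline{A\sqcap B}=\overline A\sqcup\overline B$, $\overline{\Diamond A}=\Diamond\overline A$. A weighted term is $r.A$ ($r>0$); a sequent $\vdash\Gamma$ has $\Gamma$ a finite (possibly empty) multiset of weighted terms; a hypersequent is a nonempty finite multiset of sequents $\vdash\Gamma_1\mid\cdots\mid\vdash\Gamma_n$; $G\mid\vdash\Gamma$ adds a sequent. For a finite (possibly empty) sequence $\vec r=(r_1,\dots,r_n)$ of positive reals, $\vec r.A$ is the multiset $r_1.A,\dots,r_n.A$, $\sum\vec r=r_1+\dots+r_n$, $s\vec r=(sr_1,\dots,sr_n)$; $s.\Gamma$ multiplies all weights by $s>0$; if $\Gamma=r_1.A_1,\dots,r_n.A_n$ then $\Diamond\Gamma=r_1.\Diamond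 A_1,\dots,r_n.\Diamond A_n$. The calculus $\mathbf{HMR}$ has the rules: INIT: $\vdash$ with no premises. W: from $G$ infer $G\mid\vdash\Gamma$. C: from $G\mid\vdash\Gamma\mid\vdash\Gamma$ infer $G\mid\vdash\Gamma$. S: from $G\mid\vdash\Gamma_1,\Gamma_2$ infer $G\mid\vdash\Gamma_1\mid\vdash\Gamma_2$. M: from $G\mid\vdash\Gamma_1$ and $G\mid\vdash\Gamma_2$ infer $G\mid\vdash\Gamma_1,\Gamma_2$. T: for $r>0$, from $G\mid\vdash r.\Gamma$ infer $G\mid\vdash\Gamma$. ID: if $\sum\vec r=\sum\vec s$, from $G\mid\vdash\Gamma$ infer $G\mid\vdash\Gamma,\vec r.x,\vec s.\overline{x}$ ($x$ a variable). 0: from $G\mid\vdash\Gamma$ infer $G\mid\vdash\Gamma,\vec r.0$. $+$: from $G\mid\vdash\Gamma,\vec r.A,\vec r.B$ infer $G\mid\vdash\Gamma,\vec r.(A+B)$. $\times$: from $G\mid\vdash\Gamma,(s\vec r).A$ infer $G\mid\vdash\Gamma,\vec r.(sA)$. $\sqcup$: from $G\mid\vdash\Gamma,\vec r.A\mid\vdash\Gamma,\vec r.B$ infer $G\mid\vdash\Gamma,\vec r.(A\sqcup B)$. $\sqcap$: from $G\mid\vdash\Gamma,\vec r.A$ and $G\mid\vdash\Gamma,\vec r.B$ infer $G\mid\vdash\Gamma,\vec r.(A\sqcap B)$. CAN: if $\sum\vec r=\sum\vec s$, from $G\mid\vdash\Gamma,\vec s.A,\vec r.\overline A$ infer $G\mid\vdash\Gamma$.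 1: if $\sum\vec r\geq\sum\vec s$, from $G\mid\vdash\Gamma$ infer $G\mid\vdash\Gamma,\vec r.1,\vec s.\overline{1}$. $\Diamond$: if $\sum\vec r\geq\sum\vec s$, from the single-sequent hypersequent $\vdash\Gamma,\vec r.1,\vec s.\overline 1$ infer the single-sequent hypersequent $\vdash\Diamond\Gamma,\vec r.1,\vec s.\overline 1$. A derivation is a finite tree of rule instances whose leaves are INIT; it is CAN-free if it contains no instance of CAN. -}

module Defs where

open import Level using (0ℓ)
open import Data.Nat using (ℕ)
open import Data.Bool using (Bool; true; false)
open import Data.Product using (Σ; ∃; _×_; _,_; proj₁; proj₂)
open import Data.Sum using (_⊎_)
open import Data.List using (List; []; _∷_; _++_; map; foldr)
open import Data.List.Relation.Unary.All using (All)
open import Data.List.Relation.Binary.Pointwise using (Pointwise)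
open import Data.List.Relation.Binary.Permutation.Propositional using (_↭_)
open import Relation.Binary.PropositionalEquality using (_≡_; _≢_)
open import Relation.Binary.Structures using (IsStrictTotalOrder)
open import Algebra.Structures using (IsCommutativeRing)

-- The real numbers, axiomatised as a Dedekind-complete ordered field.
-- (agda-stdlib has no reals; every model of these axioms is isomorphic
-- to ℝ, so quantifying over all models is the same as speaking of ℝ.)

record RealNumbers : Set₁ where
  infixl 6 _+_
  infixl 7 _*_
  infix 4 _<_ _≤_
  field
    Carrier : Set
    _+_ _*_ : Carrier → Carrier → Carrier
    -_      : Carrier → Carrier
    0# 1#   : Carrier
    _<_     : Carrier → Carrier → Set
    isCommutativeRing : IsCommutativeRing _≡_ _+_ _*_ -_ 0# 1#
    0≢1     : 0# ≢ 1#
    inverse : ∀ x → x ≢ 0# → ∃ λ y → x * y ≡ 1#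
    isStrictTotalOrder : IsStrictTotalOrder _≡_ _<_
    +-mono-< : ∀ {a b} c → a < b → a + c < b + c
    *-pos    : ∀ {a b} → 0# < a → 0# < b → 0# < a * b

  _≤_ : Carrier → Carrier → Set
  a ≤ b = a < b ⊎ a ≡ b

  field
    complete : (P : Carrier → Set) → ∃ P → (∃ λ u → ∀ x → P x → x ≤ u) →
               ∃ λ s → (∀ x → P x → x ≤ s) × (∀ u → (∀ x → P x → x ≤ u) → s ≤ u)

module HMR (ℝ : RealNumbers) where
  open RealNumbers ℝ

  ℝ⁺ : Set
  ℝ⁺ = Σ Carrier (λ r → 0# < r)

  _*⁺_ : ℝ⁺ → ℝ⁺ → ℝ⁺
  (a , p) *⁺ (b , q) = a * b , *-pos p q

  infixl 6 _⊕_
  infixl 5 _⊔_ _⊓_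
  infixr 7 _·_
  data Term : Set where
    var    : ℕ → Term
    covar  : ℕ → Term
    t0     : Term
    t1     : Term
    t1̄     : Term
    _⊕_    : Term → Term → Term
    _·_    : ℝ⁺ → Term → Term
    _⊔_    : Term → Term → Term
    _⊓_    : Term → Term → Term
    ◇      : Term → Term

  neg : Term → Term
  neg (var x)   = covar x
  neg (covar x) = var x
  neg t0        = t0
  neg t1        = t1̄
  neg t1̄        = t1
  neg (A ⊕ B)   = neg A ⊕ neg B
  neg (r · A)   = r · neg A
  neg (A ⊔ B)   = neg A ⊓ neg B
  neg (A ⊓ B)   = neg A ⊔ neg B
  neg (◇ A)     = ◇ (neg A)

  -- weighted terms, sequents (multisets as lists), hypersequents
  WTerm : Set
  WTerm = ℝ⁺ × Term

  Seq : Set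
  Seq = List WTerm

  HS : Set
  HS = List Seq

  _≈_ : HS → HS → Set
  H ≈ H' = Σ HS λ K → Pointwise _↭_ H K × K ↭ H'

  infixl 4 _∣_
  _∣_ : HS → Seq → HS
  G ∣ Γ = G ++ (Γ ∷ [])

  infix 8 _∙_
  _∙_ : List ℝ⁺ → Term → Seq
  rs ∙ A = map (λ r → r , A) rs

  ∑ : List ℝ⁺ → Carrier
  ∑ = foldr (λ r acc → proj₁ r + acc) 0#

  _⋆_ : ℝ⁺ → List ℝ⁺ → List ℝ⁺
  s ⋆ rs = map (s *⁺_) rs

  scale : ℝ⁺ → Seq → Seq
  scale s Γ = map (λ w → (s *⁺ proj₁ w) , proj₂ w) Γ

  ◇s : Seq → Seq
  ◇s Γ = map (λ w → proj₁ w , ◇ (proj₂ w)) Γ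

  -- Derivations in HMR.  The flag b says whether CAN may be used:
  -- Der true = derivations of HMR, Der false = CAN-free derivations.
  -- The constructor ex identifies hypersequents that are equal as multisets.
  data Der (b : Bool) : HS → Set where
    ex   : ∀ {H H'} → H ≈ H' → Der b H → Der b H'
    INIT : Der b ([] ∷ [])
    W    : ∀ {G Γ} → Der b G → Der b (G ∣ Γ)
    C    : ∀ {G Γ} → Der b (G ∣ Γ ∣ Γ) → Der b (G ∣ Γ)
    S    : ∀ {G Γ₁ Γ₂} → Der b (G ∣ Γ₁ ++ Γ₂) → Der b (G ∣ Γ₁ ∣ Γ₂)
    M    : ∀ {G Γ₁ Γ₂} → Der b (G ∣ Γ₁) → Der b (G ∣ Γ₂) → Der b (G ∣ Γ₁ ++ Γ₂)
    T    : ∀ {G Γ} (r : ℝ⁺) → Der b (G ∣ scale r Γ) → Der b (G ∣ Γ)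
    ID   : ∀ {G Γ rs ss} x → ∑ rs ≡ ∑ ss → Der b (G ∣ Γ) →
           Der b (G ∣ Γ ++ rs ∙ var x ++ ss ∙ covar x)
    R0   : ∀ {G Γ rs} → Der b (G ∣ Γ) → Der b (G ∣ Γ ++ rs ∙ t0)
    R+   : ∀ {G Γ rs A B} → Der b (G ∣ Γ ++ rs ∙ A ++ rs ∙ B) →
           Der b (G ∣ Γ ++ rs ∙ (A ⊕ B))
    R×   : ∀ {G Γ rs A} (s : ℝ⁺) → Der b (G ∣ Γ ++ (s ⋆ rs) ∙ A) →
           Der b (G ∣ Γ ++ rs ∙ (s · A))
    R⊔   : ∀ {G Γ rs A B} → Der b (G ∣ Γ ++ rs ∙ A ∣ Γ ++ rs ∙ B) →
           Der b (G ∣ Γ ++ rs ∙ (A ⊔ B))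
    R⊓   : ∀ {G Γ rs A B} → Der b (G ∣ Γ ++ rs ∙ A) → Der b (G ∣ Γ ++ rs ∙ B) →
           Der b (G ∣ Γ ++ rs ∙ (A ⊓ B))
    CAN  : ∀ {G Γ rs ss} → b ≡ true → (A : Term) → ∑ rs ≡ ∑ ss →
           Der b (G ∣ Γ ++ ss ∙ A ++ rs ∙ neg A) → Der b (G ∣ Γ)
    R1   : ∀ {G Γ rs ss} → ∑ ss ≤ ∑ rs → Der b (G ∣ Γ) →
           Der b (G ∣ Γ ++ rs ∙ t1 ++ ss ∙ t1̄)
    R◇   : ∀ {Γ rs ss} → ∑ ss ≤ ∑ rs → Der b ([] ∣ Γ ++ rs ∙ t1 ++ ss ∙ t1̄) →
           Der b ([] ∣ ◇s Γ ++ rs ∙ t1 ++ ss ∙ t1̄)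

  data LogicalInstance : HS → List HS → Set where
    i0 : ∀ G Γ rs → LogicalInstance (G ∣ Γ ++ rs ∙ t0) ((G ∣ Γ) ∷ [])
    i+ : ∀ G Γ rs A B →
         LogicalInstance (G ∣ Γ ++ rs ∙ (A ⊕ B)) ((G ∣ Γ ++ rs ∙ A ++ rs ∙ B) ∷ [])
    i× : ∀ G Γ rs A s →
         LogicalInstance (G ∣ Γ ++ rs ∙ (s · A)) ((G ∣ Γ ++ (s ⋆ rs) ∙ A) ∷ [])
    i⊔ : ∀ G Γ rs A B →
         LogicalInstance (G ∣ Γ ++ rs ∙ (A ⊔ B)) ((G ∣ Γ ++ rs ∙ A ∣ Γ ++ rs ∙ B) ∷ [])
    i⊓ : ∀ G Γ rs A B →
         LogicalInstance (G ∣ Γ ++ rs ∙ (A ⊓ B))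
                         ((G ∣ Γ ++ rs ∙ A) ∷ (G ∣ Γ ++ rs ∙ B) ∷ [])
    i◇ : ∀ Γ rs ss → ∑ ss ≤ ∑ rs →
         LogicalInstance ([] ∣ ◇s Γ ++ rs ∙ t1 ++ ss ∙ t1̄)
                         (([] ∣ Γ ++ rs ∙ t1 ++ ss ∙ t1̄) ∷ [])

{-# OPTIONS --safe #-}
-- A hypersequent K absorbs Γ if Γ may be erased from every derivable L ∣ Γ with L ⊇ K.
-- Invertibility is proved by induction on the derivation of a hypersequent H: if K absorbs the
-- reducts of all members of H, then K is derivable.  The delicate cases are those where the
-- occurrences of one formula are treated differently: for M under the reduction of A ⊔ B one must
-- absorb Γ , p⃗.A , q⃗.B given that both Γ , r⃗.A and Γ , r⃗.B are absorbed, where r⃗ = p⃗ , q⃗, and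
-- for ⊓ one must derive Γ , p⃗.A , q⃗.B from Γ , r⃗.A and Γ , r⃗.B.  Both follow from the identity
--   Σ_{t ∈ r⃗} t.(Γ , p⃗.A , q⃗.B) = Σ_{t ∈ p⃗} t.(Γ , r⃗.A) , Σ_{t ∈ q⃗} t.(Γ , r⃗.B),
-- read through S, T, C in one direction and through M in the other.
-- For ◇ one strips the outermost ◇ of every formula in a derivation of ◇Γ , r⃗.1 , s⃗.1̄.
module Submission where

open import Defs
open import Algebra.Bundles using (CommutativeRing)
import Algebra.Properties.Ring as RingProperties
import Algebra.Solver.CommutativeMonoid as CommutativeMonoidSolver
open import Data.Bool using (Bool; true; false; not; if_then_else_)
open import Data.Empty using (⊥; ⊥-elim)
open import Data.List using (List; []; _∷_; _++_; map; concatMap)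
open import Data.List.Properties
  using (∷-injective; ++-assoc; ++-identityʳ; map-++; concatMap-++)
open import Data.List.Membership.Propositional using (_∈_)
open import Data.List.Membership.Propositional.Properties using (∈-∃++; ∈-++⁺ˡ; ∈-++⁺ʳ; ∈-++⁻)
open import Data.List.Relation.Binary.Permutation.Propositional
  using (_↭_; prep; swap; ↭-refl; ↭-sym; ↭-trans; ↭-reflexive)
open import Data.List.Relation.Binary.Permutation.Propositional.Properties
  using (All-resp-↭; ++⁺; ++⁺ˡ; ++⁺ʳ; ++-comm; shift; shifts; ↭-map-inv; map⁺;
         ++-commutativeMonoid)
open import Data.List.Relation.Binary.Pointwise as PW using (Pointwise; []; _∷_)
open import Data.List.Relation.Binary.Subset.Propositional using (_⊆_)
open import Data.List.Relation.Unary.All as All using (All; []; _∷_)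
import Data.List.Relation.Unary.All.Properties as AllP
open import Data.List.Relation.Unary.Any using (here; there)
open import Data.Product using (∃; ∃₂; _×_; _,_; proj₁; proj₂)
open import Data.Sum using (_⊎_; inj₁; inj₂)
open import Data.Unit using (⊤; tt)
open import Function using (_∘_)
open import Relation.Binary.Definitions using (tri<; tri≈; tri>)
open import Relation.Binary.PropositionalEquality
  using (_≡_; refl; sym; trans; cong; cong₂; subst; subst₂)
open import Relation.Binary.Structures using (IsStrictTotalOrder)

module Invertibility (ℝ : RealNumbers) where
  open RealNumbers ℝ using
    (Carrier; _*_; _+_; -_; 0#; 1#; _<_; _≤_; *-pos; +-mono-<; 0≢1; inverse;
     isStrictTotalOrder; isCommutativeRing)
  open HMR ℝ

  D : HS → Set
  D = Der false

  -- Hypersequents behave as sets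

  ↭-≈ : ∀ {H H'} → H ↭ H' → H ≈ H'
  ↭-≈ p = _ , PW.refl ↭-refl , p

  resp-↭ : ∀ {H H'} → H ↭ H' → D H → D H'
  resp-↭ p = ex (↭-≈ p)

  resp-↭ₛ : ∀ {G Γ Γ'} → Γ ↭ Γ' → D (G ∣ Γ) → D (G ∣ Γ')
  resp-↭ₛ p = ex (_ , PW.++⁺ (PW.refl ↭-refl) (p ∷ []) , ↭-refl)

  last-∈ : ∀ G {Γ} → Γ ∈ (G ∣ Γ)
  last-∈ G = ∈-++⁺ʳ G (here refl)

  ⊆-∣ : ∀ {G Γ} → G ⊆ (G ∣ Γ)
  ⊆-∣ = ∈-++⁺ˡ

  ∣-⊆ : ∀ {G L Γ} → G ⊆ L → Γ ∈ L → (G ∣ Γ) ⊆ L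
  ∣-⊆ {G} s m i with ∈-++⁻ G i
  ... | inj₁ j = s j
  ... | inj₂ (here refl) = m

  weaken-++ : ∀ {L} L' → D L → D (L ++ L')
  weaken-++ {L} [] d = subst D (sym (++-identityʳ L)) d
  weaken-++ {L} (Γ ∷ L') d = subst D (++-assoc L (Γ ∷ []) L') (weaken-++ L' (W d))

  contract : ∀ {L Γ} → Γ ∈ L → D (L ∣ Γ) → D L
  contract {L} {Γ} m d with ∈-∃++ m
  ... | L₁ , L₂ , refl =
    resp-↭ (↭-sym p) (C (resp-↭ (++⁺ʳ (Γ ∷ []) p) d))
    where
    p : L₁ ++ Γ ∷ L₂ ↭ (L₁ ++ L₂) ∣ Γ
    p = ↭-trans (shift Γ L₁ L₂) (++-comm (Γ ∷ []) (L₁ ++ L₂))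

  contract-++ : ∀ {L'} L → L ⊆ L' → D (L' ++ L) → D L'
  contract-++ {L'} [] s d = subst D (++-identityʳ L') d
  contract-++ {L'} (Γ ∷ L) s d =
    contract-++ L (s ∘ there) (contract (∈-++⁺ˡ (s (here refl))) (resp-↭ p d))
    where
    p : L' ++ Γ ∷ L ↭ (L' ++ L) ∣ Γ
    p = ↭-trans (shift Γ L' L) (++-comm (Γ ∷ []) (L' ++ L))

  -- Weakening by `L'` turns every member of `L` into a duplicate, which contraction then removes.
  struct : ∀ {L L'} → L ⊆ L' → D L → D L'
  struct {L} {L'} s d = contract-++ L s (resp-↭ (++-comm L L') (weaken-++ L' d))

  -- Absorption of sequents.

  Abs : HS → Seq → Set
  Abs K Γ = ∀ {L} → K ⊆ L → D (L ∣ Γ) → D L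

  -- The quantification over `L` in `Abs` serves this purpose: branching rules are replayed in
  -- hypersequents larger than `K`.
  Abs-mono : ∀ {K L Γ} → K ⊆ L → Abs K Γ → Abs L Γ
  Abs-mono s a t = a (t ∘ s)

  Abs-∈ : ∀ {K Γ} → Γ ∈ K → Abs K Γ
  Abs-∈ m s = contract (s m)

  -- Absorption is contravariant: to erase `Γ`, first turn it into `Γ'` by a rule of the calculus.
  -- Most one-premise rules are replayed in this way.
  Abs-lift : ∀ {K Γ Γ'} → (∀ {G} → D (G ∣ Γ) → D (G ∣ Γ')) → Abs K Γ' → Abs K Γ
  Abs-lift f a s d = a s (f d)

  Abs-↭ : ∀ {K Γ Γ'} → Γ ↭ Γ' → Abs K Γ' → Abs K Γ
  Abs-↭ p = Abs-lift (resp-↭ₛ p)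

  Abs-++ : ∀ {K Γ₁ Γ₂} → Abs K Γ₁ → Abs K Γ₂ → Abs K (Γ₁ ++ Γ₂)
  Abs-++ a b s d = a s (b (⊆-∣ ∘ s) (S d))

  -- `INIT` and `R◇` conclude a lone sequent; weakening supplies `K`, and absorption then erases
  -- that sequent.
  Abs-single : ∀ {K Γ} → Abs K Γ → D ([] ∣ Γ) → D K
  Abs-single {K} a d = a (λ x → x) (struct (∣-⊆ {G = []} (λ ()) (last-∈ K)) d)

  Abs-scale : ∀ {K Γ} r → Abs K Γ → Abs K (scale r Γ)
  Abs-scale r = Abs-lift (T r)

  -- Given one disjunct, weakening adds the other and `R⊔` applies.
  Abs-⊔ : ∀ {K rs A B} Γ → Abs K (Γ ++ rs ∙ (A ⊔ B)) → Abs K (Γ ++ rs ∙ A) × Abs K (Γ ++ rs ∙ B)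
  Abs-⊔ {K} {rs} {A} {B} Γ a =
    (λ s d → a s (R⊔ {Γ = Γ} {rs = rs} (W d))) ,
    (λ {L} s d → a s (R⊔ {Γ = Γ} {rs = rs} (struct (∣-⊆ (⊆-∣ ∘ ⊆-∣) (last-∈ _)) d)))

  -- Conditions under which a derivation of H can be replayed, bottom-up, as a derivation of K;
  -- P K Γ reads "K accounts for the sequent Γ".
  record Simulation (P : HS → Seq → Set) : Set where
    field
      mono  : ∀ {K L Γ} → K ⊆ L → P K Γ → P L Γ
      perm  : ∀ {K Γ Γ'} → Γ ↭ Γ' → P K Γ' → P K Γ
      init  : ∀ {K} → P K [] → D K
      split : ∀ {K Γ₁ Γ₂} → P K Γ₁ → P K Γ₂ → P K (Γ₁ ++ Γ₂)
      mix   : ∀ {K} Γ₁ Γ₂ → P K (Γ₁ ++ Γ₂) →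
              (∀ {L} → K ⊆ L → P L Γ₁ → D L) → (∀ {L} → K ⊆ L → P L Γ₂ → D L) → D K
      mult  : ∀ {K Γ} r → P K Γ → P K (scale r Γ)
      axm   : ∀ {K} Γ rs ss {x} → ∑ rs ≡ ∑ ss → P K (Γ ++ rs ∙ var x ++ ss ∙ covar x) → P K Γ
      zer   : ∀ {K} Γ rs → P K (Γ ++ rs ∙ t0) → P K Γ
      plus  : ∀ {K} Γ rs {A B} → P K (Γ ++ rs ∙ (A ⊕ B)) → P K (Γ ++ rs ∙ A ++ rs ∙ B)
      times : ∀ {K} Γ rs {A} s → P K (Γ ++ rs ∙ (s · A)) → P K (Γ ++ (s ⋆ rs) ∙ A)
      sup   : ∀ {K} Γ rs {A B} → P K (Γ ++ rs ∙ (A ⊔ B)) →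
              P K (Γ ++ rs ∙ A) × P K (Γ ++ rs ∙ B)
      inf   : ∀ {K} Γ rs {A B} → P K (Γ ++ rs ∙ (A ⊓ B)) →
              (∀ {L} → K ⊆ L → P L (Γ ++ rs ∙ A) → D L) →
              (∀ {L} → K ⊆ L → P L (Γ ++ rs ∙ B) → D L) → D K
      one   : ∀ {K} Γ rs ss → ∑ ss ≤ ∑ rs → P K (Γ ++ rs ∙ t1 ++ ss ∙ t1̄) → P K Γ
      dia   : ∀ {K} Γ rs ss → ∑ ss ≤ ∑ rs → P K (◇s Γ ++ rs ∙ t1 ++ ss ∙ t1̄) →
              D ([] ∣ Γ ++ rs ∙ t1 ++ ss ∙ t1̄) →
              (∀ {L} → P L (Γ ++ rs ∙ t1 ++ ss ∙ t1̄) → D L) → D K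

  module _ {P} (sim : Simulation P) where
    open Simulation sim

    private
      ∣⁻ : ∀ {K} G {Γ} → All (P K) (G ∣ Γ) → All (P K) G × P K Γ
      ∣⁻ G = AllP.∷ʳ⁻

      ∣⁺ : ∀ {K G Γ} → All (P K) G → P K Γ → All (P K) (G ∣ Γ)
      ∣⁺ = AllP.∷ʳ⁺

      Pointwise-↭ : ∀ {K H H'} → Pointwise _↭_ H H' → All (P K) H' → All (P K) H
      Pointwise-↭ [] [] = []
      Pointwise-↭ (p ∷ ps) (a ∷ as) = perm p a ∷ Pointwise-↭ ps as

    -- Induction on the derivation, with `K` generalised. At a branching rule, `mix` and `inf`
    -- receive the induction hypotheses as continuations valid for every `L` above `K`; `mono`
    -- carries the side sequents there.
    simulate : ∀ {H K} → D H → All (P K) H → D K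
    simulate (ex (_ , pw , p) d) a = simulate d (Pointwise-↭ pw (All-resp-↭ (↭-sym p) a))
    simulate INIT (p ∷ []) = init p
    simulate (W {G} d) a = simulate d (proj₁ (∣⁻ G a))
    simulate (C {G} d) a with ∣⁻ G a
    ... | g , p = simulate d (∣⁺ (∣⁺ g p) p)
    simulate (S {G} {Γ₁} d) a with ∣⁻ (G ∣ Γ₁) a
    ... | g₁ , p₂ with ∣⁻ G g₁
    ... | g , p₁ = simulate d (∣⁺ g (split p₁ p₂))
    simulate (M {G} {Γ₁} {Γ₂} d e) a with ∣⁻ G a
    ... | g , p = mix Γ₁ Γ₂ p
      (λ s q → simulate d (∣⁺ (All.map (mono s) g) q))
      (λ s q → simulate e (∣⁺ (All.map (mono s) g) q))
    simulate (T {G} r d) a with ∣⁻ G a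
    ... | g , p = simulate d (∣⁺ g (mult r p))
    simulate (ID {G} {Γ} {rs} {ss} x eq d) a with ∣⁻ G a
    ... | g , p = simulate d (∣⁺ g (axm Γ rs ss eq p))
    simulate (R0 {G} {Γ} {rs} d) a with ∣⁻ G a
    ... | g , p = simulate d (∣⁺ g (zer Γ rs p))
    simulate (R+ {G} {Γ} {rs} d) a with ∣⁻ G a
    ... | g , p = simulate d (∣⁺ g (plus Γ rs p))
    simulate (R× {G} {Γ} {rs} s d) a with ∣⁻ G a
    ... | g , p = simulate d (∣⁺ g (times Γ rs s p))
    simulate (R⊔ {G} {Γ} {rs} d) a with ∣⁻ G a
    ... | g , p = simulate d (∣⁺ (∣⁺ g (proj₁ (sup Γ rs p))) (proj₂ (sup Γ rs p)))
    simulate (R⊓ {G} {Γ} {rs} d e) a with ∣⁻ G a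
    ... | g , p = inf Γ rs p
      (λ s q → simulate d (∣⁺ (All.map (mono s) g) q))
      (λ s q → simulate e (∣⁺ (All.map (mono s) g) q))
    simulate (CAN () _ _ _)
    simulate (R1 {G} {Γ} {rs} {ss} le d) a with ∣⁻ G a
    ... | g , p = simulate d (∣⁺ g (one Γ rs ss le p))
    -- The premise of ◇ has no side sequents, so its continuation is available at every `L`. The
    -- premise derivation itself is passed too, for simulations that stop at ◇.
    simulate (R◇ {Γ} {rs} {ss} le d) (p ∷ []) = dia Γ rs ss le p d (λ q → simulate d (q ∷ []))

  -- Irrelevance of the positivity proofs carried by the weights

  infix 4 _≐_ _≃_

  -- The axioms leave room for several proofs of `0# < r`, so weights with equal underlying reals
  -- need not be equal, and arithmetic identities only yield `_≐_`.
  data _≐_ : WTerm → WTerm → Set where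
    same : ∀ {r r' A} → proj₁ r ≡ proj₁ r' → (r , A) ≐ (r' , A)

  ≐-refl : ∀ {w} → w ≐ w
  ≐-refl = same refl

  Pointwise-++⁻ : ∀ {X Y : Set} {R : X → Y → Set} xs {ys zs} → Pointwise R (xs ++ ys) zs →
                  ∃₂ λ zs₁ zs₂ → zs ≡ zs₁ ++ zs₂ × Pointwise R xs zs₁ × Pointwise R ys zs₂
  Pointwise-++⁻ [] q = _ , _ , refl , [] , q
  Pointwise-++⁻ (x ∷ xs) (p ∷ q) with Pointwise-++⁻ xs q
  ... | _ , _ , refl , q₁ , q₂ = _ , _ , refl , p ∷ q₁ , q₂

  Pointwise-↭ˡ : ∀ {X Y : Set} {R : X → Y → Set} {xs xs' ys} → xs ↭ xs' → Pointwise R xs' ys →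
                 ∃ λ ys' → Pointwise R xs ys' × ys' ↭ ys
  Pointwise-↭ˡ _↭_.refl q = _ , q , ↭-refl
  Pointwise-↭ˡ (prep _ p) (r ∷ q) with Pointwise-↭ˡ p q
  ... | _ , q' , p' = _ , r ∷ q' , prep _ p'
  Pointwise-↭ˡ (swap _ _ p) (r₁ ∷ r₂ ∷ q) with Pointwise-↭ˡ p q
  ... | _ , q' , p' = _ , r₂ ∷ r₁ ∷ q' , swap _ _ p'
  Pointwise-↭ˡ (_↭_.trans p₁ p₂) q with Pointwise-↭ˡ p₂ q
  ... | _ , q' , p' with Pointwise-↭ˡ p₁ q'
  ... | _ , q'' , p'' = _ , q'' , ↭-trans p'' p'

  SameWeights : List ℝ⁺ → List ℝ⁺ → Set
  SameWeights = Pointwise (λ r r' → proj₁ r ≡ proj₁ r')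

  ∙-≐⁺ : ∀ {rs rs' A} → SameWeights rs rs' → Pointwise _≐_ (rs ∙ A) (rs' ∙ A)
  ∙-≐⁺ q = PW.map⁺ _ _ (PW.map same q)

  ∙-≐⁻ : ∀ rs {A Δ} → Pointwise _≐_ (rs ∙ A) Δ → ∃ λ rs' → Δ ≡ rs' ∙ A × SameWeights rs rs'
  ∙-≐⁻ [] [] = [] , refl , []
  ∙-≐⁻ (r ∷ rs) (same e ∷ q) with ∙-≐⁻ rs q
  ... | _ , refl , q' = _ , refl , e ∷ q'

  ◇s-≐⁻ : ∀ Γ {Δ} → Pointwise _≐_ (◇s Γ) Δ → ∃ λ Γ' → Δ ≡ ◇s Γ' × Pointwise _≐_ Γ Γ'
  ◇s-≐⁻ [] [] = [] , refl , []
  ◇s-≐⁻ (w ∷ Γ) (same e ∷ q) with ◇s-≐⁻ Γ q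
  ... | _ , refl , q' = _ , refl , same e ∷ q'

  scale-≐ : ∀ r {Γ Γ'} → Pointwise _≐_ Γ Γ' → Pointwise _≐_ (scale r Γ) (scale r Γ')
  scale-≐ r q = PW.map⁺ _ _ (PW.map (λ { (same e) → same (cong (proj₁ r *_) e) }) q)

  ⋆-same : ∀ s {rs rs'} → SameWeights rs rs' → SameWeights (s ⋆ rs) (s ⋆ rs')
  ⋆-same s q = PW.map⁺ _ _ (PW.map (cong (proj₁ s *_)) q)

  ∑-same : ∀ {rs rs'} → SameWeights rs rs' → ∑ rs ≡ ∑ rs'
  ∑-same [] = refl
  ∑-same (e ∷ q) = cong₂ _+_ e (∑-same q)

  Reweighted : HS → Seq → Set
  Reweighted K Γ = ∃ λ Γ' → Pointwise _≐_ Γ Γ' × Abs K Γ'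

  private
    reweighted⁻ : ∀ {K} Γ rs {A} → Reweighted K (Γ ++ rs ∙ A) →
             ∃₂ λ Γ' rs' → Pointwise _≐_ Γ Γ' × SameWeights rs rs' × Abs K (Γ' ++ rs' ∙ A)
    reweighted⁻ Γ rs (_ , q , a) with Pointwise-++⁻ Γ q
    ... | Γ' , _ , refl , q₁ , q₂ with ∙-≐⁻ rs q₂
    ... | rs' , refl , e = Γ' , rs' , q₁ , e , a

    reweighted₂⁻ : ∀ {K} Γ rs ss {A B} → Reweighted K (Γ ++ rs ∙ A ++ ss ∙ B) →
              ∃ λ Γ' → ∃₂ λ rs' ss' → Pointwise _≐_ Γ Γ' × SameWeights rs rs' ×
              SameWeights ss ss' × Abs K (Γ' ++ rs' ∙ A ++ ss' ∙ B)
    reweighted₂⁻ Γ rs ss {A} (_ , q , a) with Pointwise-++⁻ Γ q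
    ... | Γ' , _ , refl , q₁ , q₂ with Pointwise-++⁻ (rs ∙ A) q₂
    ... | _ , _ , refl , q₃ , q₄ with ∙-≐⁻ rs q₃ | ∙-≐⁻ ss q₄
    ... | rs' , refl , e | ss' , refl , f = Γ' , rs' , ss' , q₁ , e , f , a

  -- Each rule is reapplied to the reweighted sequent; its side condition survives because sums
  -- depend only on the underlying reals.
  Reweighted-simulation : Simulation Reweighted
  Reweighted-simulation = record
    { mono = λ { s (_ , q , a) → _ , q , Abs-mono s a }
    ; perm = perm'
    ; init = λ { (_ , [] , a) → Abs-single a INIT }
    ; split = λ { (_ , q₁ , a₁) (_ , q₂ , a₂) → _ , PW.++⁺ q₁ q₂ , Abs-++ a₁ a₂ }
    ; mix = mix'
    ; mult = λ { r (_ , q , a) → _ , scale-≐ r q , Abs-scale r a }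
    ; axm = axm'
    ; zer = zer'
    ; plus = plus'
    ; times = times'
    ; sup = sup'
    ; inf = inf'
    ; one = one'
    ; dia = dia'
    }
    where
    perm' : ∀ {K Γ Γ'} → Γ ↭ Γ' → Reweighted K Γ' → Reweighted K Γ
    perm' p (_ , q , a) with Pointwise-↭ˡ p q
    ... | _ , q' , p' = _ , q' , Abs-↭ p' a

    mix' : ∀ {K} Γ₁ Γ₂ → Reweighted K (Γ₁ ++ Γ₂) → (∀ {L} → K ⊆ L → Reweighted L Γ₁ → D L) →
           (∀ {L} → K ⊆ L → Reweighted L Γ₂ → D L) → D K
    mix' {K} Γ₁ Γ₂ (_ , q , a) d e with Pointwise-++⁻ Γ₁ q
    -- Each premise is replayed with its own reweighted part added to `K`, where membership gives
    -- absorption; `M` joins the parts and `a` erases the result.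
    ... | _ , _ , refl , q₁ , q₂ = a (λ x → x)
      (M (d ⊆-∣ (_ , q₁ , Abs-∈ (last-∈ K))) (e ⊆-∣ (_ , q₂ , Abs-∈ (last-∈ K))))

    axm' : ∀ {K} Γ rs ss {x} → ∑ rs ≡ ∑ ss →
           Reweighted K (Γ ++ rs ∙ var x ++ ss ∙ covar x) → Reweighted K Γ
    axm' Γ rs ss eq p with reweighted₂⁻ Γ rs ss p
    ... | Γ' , rs' , ss' , q , e , f , a =
      _ , q , Abs-lift (ID {rs = rs'} {ss = ss'} _ (trans (sym (∑-same e)) (trans eq (∑-same f)))) a

    zer' : ∀ {K} Γ rs → Reweighted K (Γ ++ rs ∙ t0) → Reweighted K Γ
    zer' Γ rs p with reweighted⁻ Γ rs p
    ... | _ , rs' , q , e , a = _ , q , Abs-lift (R0 {rs = rs'}) a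

    plus' : ∀ {K} Γ rs {A B} → Reweighted K (Γ ++ rs ∙ (A ⊕ B)) →
            Reweighted K (Γ ++ rs ∙ A ++ rs ∙ B)
    plus' Γ rs p with reweighted⁻ Γ rs p
    ... | Γ' , rs' , q , e , a =
      _ , PW.++⁺ q (PW.++⁺ (∙-≐⁺ e) (∙-≐⁺ e)) , Abs-lift (R+ {Γ = Γ'} {rs = rs'}) a

    times' : ∀ {K} Γ rs {A} s → Reweighted K (Γ ++ rs ∙ (s · A)) → Reweighted K (Γ ++ (s ⋆ rs) ∙ A)
    times' Γ rs s p with reweighted⁻ Γ rs p
    ... | Γ' , rs' , q , e , a =
      _ , PW.++⁺ q (∙-≐⁺ (⋆-same s e)) , Abs-lift (R× {Γ = Γ'} {rs = rs'} s) a

    sup' : ∀ {K} Γ rs {A B} → Reweighted K (Γ ++ rs ∙ (A ⊔ B)) →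
           Reweighted K (Γ ++ rs ∙ A) × Reweighted K (Γ ++ rs ∙ B)
    sup' Γ rs p with reweighted⁻ Γ rs p
    ... | Γ' , rs' , q , e , a =
      (_ , PW.++⁺ q (∙-≐⁺ e) , proj₁ (Abs-⊔ {rs = rs'} Γ' a)) ,
      (_ , PW.++⁺ q (∙-≐⁺ e) , proj₂ (Abs-⊔ {rs = rs'} Γ' a))

    inf' : ∀ {K} Γ rs {A B} → Reweighted K (Γ ++ rs ∙ (A ⊓ B)) →
           (∀ {L} → K ⊆ L → Reweighted L (Γ ++ rs ∙ A) → D L) →
           (∀ {L} → K ⊆ L → Reweighted L (Γ ++ rs ∙ B) → D L) → D K
    inf' {K} Γ rs p d₁ d₂ with reweighted⁻ Γ rs p
    ... | Γ' , rs' , q , e , a = a (λ x → x) (R⊓ {Γ = Γ'} {rs = rs'}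
      (d₁ ⊆-∣ (_ , PW.++⁺ q (∙-≐⁺ e) , Abs-∈ (last-∈ K)))
      (d₂ ⊆-∣ (_ , PW.++⁺ q (∙-≐⁺ e) , Abs-∈ (last-∈ K))))

    one' : ∀ {K} Γ rs ss → ∑ ss ≤ ∑ rs → Reweighted K (Γ ++ rs ∙ t1 ++ ss ∙ t1̄) → Reweighted K Γ
    one' Γ rs ss le p with reweighted₂⁻ Γ rs ss p
    ... | Γ' , rs' , ss' , q , e , f , a =
      _ , q , Abs-lift (R1 {rs = rs'} {ss = ss'} (subst₂ _≤_ (∑-same f) (∑-same e) le)) a

    dia' : ∀ {K} Γ rs ss → ∑ ss ≤ ∑ rs → Reweighted K (◇s Γ ++ rs ∙ t1 ++ ss ∙ t1̄) →
           D ([] ∣ Γ ++ rs ∙ t1 ++ ss ∙ t1̄) →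
           (∀ {L} → Reweighted L (Γ ++ rs ∙ t1 ++ ss ∙ t1̄) → D L) → D K
    dia' Γ rs ss le p _ d with reweighted₂⁻ (◇s Γ) rs ss p
    ... | _ , rs' , ss' , q , e , f , a with ◇s-≐⁻ Γ q
    ... | Γ' , refl , q' = Abs-single a (R◇ {Γ = Γ'} {rs = rs'} {ss = ss'}
      (subst₂ _≤_ (∑-same f) (∑-same e) le)
      (d (_ , PW.++⁺ q' (PW.++⁺ (∙-≐⁺ e) (∙-≐⁺ f)) , Abs-∈ (here refl))))

  resp-≐ : ∀ {G Γ Γ'} → Pointwise _≐_ Γ Γ' → D (G ∣ Γ) → D (G ∣ Γ')
  resp-≐ {G} q d = simulate Reweighted-simulation d (AllP.∷ʳ⁺
    (All.tabulate (λ m → _ , PW.refl ≐-refl , Abs-∈ (⊆-∣ m)))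
    (_ , q , Abs-∈ (last-∈ G)))

  erase : WTerm → Carrier × Term
  erase (r , A) = proj₁ r , A

  _≃_ : Seq → Seq → Set
  Γ ≃ Γ' = map erase Γ ↭ map erase Γ'

  erase-≐ : ∀ Γ Γ' → map erase Γ ≡ map erase Γ' → Pointwise _≐_ Γ Γ'
  erase-≐ [] [] _ = []
  erase-≐ ((r , A) ∷ Γ) ((r' , A') ∷ Γ') e with ∷-injective e
  ... | e₁ , e₂ = ≐⁺ (cong proj₁ e₁) (cong proj₂ e₁) ∷ erase-≐ Γ Γ' e₂
    where
    ≐⁺ : proj₁ r ≡ proj₁ r' → A ≡ A' → (r , A) ≐ (r' , A')
    ≐⁺ e refl = same e

  resp-≃ : ∀ {G Γ Γ'} → Γ ≃ Γ' → D (G ∣ Γ) → D (G ∣ Γ')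
  resp-≃ {Γ = Γ} {Γ'} p d with ↭-map-inv erase p
  ... | Γ'' , e , p' = resp-≐ (erase-≐ Γ'' Γ' (sym e)) (resp-↭ₛ p' d)

  -- Positive multiples and their sums

  CR : CommutativeRing _ _
  CR = record { isCommutativeRing = isCommutativeRing }

  open CommutativeRing CR
    using (*-comm; *-assoc; *-identityˡ; zeroʳ; +-identityˡ; -‿inverseˡ; -‿inverseʳ; ring)
  open RingProperties ring using (-‿distribʳ-*; -‿distribˡ-*; -‿involutive)
  open IsStrictTotalOrder isStrictTotalOrder using (compare; irrefl) renaming (trans to <-trans)

  neg-pos : ∀ {x} → x < 0# → 0# < - x
  neg-pos {x} l = subst₂ _<_ (-‿inverseʳ x) (+-identityˡ (- x)) (+-mono-< (- x) l)

  -- Squaring `- 1#` would give `0# < 1#`, while adding `1#` would give `1# < 0#`.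
  0≮-1 : 0# < - 1# → ⊥
  0≮-1 l = irrefl refl (<-trans 0<1 1<0)
    where
    0<1 : 0# < 1#
    0<1 = subst (0# <_) (trans (sym (-‿distribˡ-* 1# (- 1#)))
      (trans (cong -_ (*-identityˡ (- 1#))) (-‿involutive 1#))) (*-pos l l)
    1<0 : 1# < 0#
    1<0 = subst₂ _<_ (+-identityˡ 1#) (-‿inverseˡ 1#) (+-mono-< 1# l)

  -- The field inverse `y` of `r` must be positive: otherwise it is zero, or `r * (- y)`, which is
  -- `- 1#`, would be positive.
  inverse⁺ : (r : ℝ⁺) → ∃ λ s → proj₁ s * proj₁ r ≡ 1#
  inverse⁺ (r , r>0) with inverse r (λ e → irrefl (sym e) r>0)
  ... | y , ry≡1 with compare 0# y
  ... | tri< y>0 _ _ = (y , y>0) , trans (*-comm y r) ry≡1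
  ... | tri≈ _ refl _ = ⊥-elim (0≢1 (trans (sym (zeroʳ r)) ry≡1))
  ... | tri> _ _ y<0 = ⊥-elim (0≮-1 (subst (0# <_)
    (trans (sym (-‿distribʳ-* r y)) (cong -_ ry≡1)) (*-pos r>0 (neg-pos y<0))))

  -- Read downwards, `T` divides by its parameter; multiplication by `r` is division by the inverse
  -- of `r`.
  scale⁺ : ∀ {G Γ} r → D (G ∣ Γ) → D (G ∣ scale r Γ)
  scale⁺ {G} {Γ} r d with inverse⁺ r
  ... | s , sr≡1 = T s (resp-≐ (unscale Γ) d)
    where
    unscale : ∀ Γ → Pointwise _≐_ Γ (scale s (scale r Γ))
    unscale [] = []
    unscale ((t , A) ∷ Γ) = same (sym (trans (sym (*-assoc _ _ _))
      (trans (cong (_* proj₁ t) sr≡1) (*-identityˡ _)))) ∷ unscale Γ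

  ⨁ : List ℝ⁺ → Seq → Seq
  ⨁ rs Γ = concatMap (λ r → scale r Γ) rs

  ⨁-intro : ∀ {G Γ} r rs → D (G ∣ Γ) → D (G ∣ ⨁ (r ∷ rs) Γ)
  ⨁-intro {G} r [] d = subst (λ Δ → D (G ∣ Δ)) (sym (++-identityʳ _)) (scale⁺ r d)
  ⨁-intro r (s ∷ rs) d = M (scale⁺ r d) (⨁-intro s rs d)

  -- The list must be nonempty: an empty sum is the empty sequent, and since `L ∣ []` is always
  -- derivable, absorbing it would make every `L` above `K` derivable.
  Abs-⨁ : ∀ {K Γ} r rs → Abs K Γ → Abs K (⨁ (r ∷ rs) Γ)
  Abs-⨁ {K} r [] a = subst (Abs K) (sym (++-identityʳ _)) (Abs-scale r a)
  Abs-⨁ r (s ∷ rs) a = Abs-++ (Abs-scale r a) (Abs-⨁ s rs a)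

  open CommutativeMonoidSolver (++-commutativeMonoid {A = WTerm}) using (solve; _⊜_)
    renaming (_⊕_ to _⊞_)

  ≃-trans : ∀ {Γ Δ Θ} → Γ ≃ Δ → Δ ≃ Θ → Γ ≃ Θ
  ≃-trans = ↭-trans

  ↭⇒≃ : ∀ {Γ Γ'} → Γ ↭ Γ' → Γ ≃ Γ'
  ↭⇒≃ = map⁺ erase

  ≃-++ : ∀ {Γ Γ' Δ Δ'} → Γ ≃ Γ' → Δ ≃ Δ' → (Γ ++ Δ) ≃ (Γ' ++ Δ')
  ≃-++ {Γ} {Γ'} p q = subst₂ _↭_ (sym (map-++ erase Γ _)) (sym (map-++ erase Γ' _)) (++⁺ p q)

  ⨁-++ : ∀ rs Γ Δ → ⨁ rs (Γ ++ Δ) ↭ ⨁ rs Γ ++ ⨁ rs Δ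
  ⨁-++ [] Γ Δ = ↭-refl
  ⨁-++ (r ∷ rs) Γ Δ = ↭-trans (++⁺ (↭-reflexive (map-++ _ Γ Δ)) (⨁-++ rs Γ Δ))
    (solve 4 (λ a b c d → (a ⊞ b) ⊞ (c ⊞ d) ⊜ (a ⊞ c) ⊞ (b ⊞ d)) ↭-refl
      (scale r Γ) (scale r Δ) (⨁ rs Γ) (⨁ rs Δ))

  ⨁-[] : ∀ rs → ⨁ rs [] ≡ []
  ⨁-[] [] = refl
  ⨁-[] (r ∷ rs) = ⨁-[] rs

  ⨁-singleton : ∀ r ss A → scale r (ss ∙ A) ≃ ⨁ ss ((r ∷ []) ∙ A)
  ⨁-singleton r [] A = ↭-refl
  ⨁-singleton r (s ∷ ss) A = ≃-++ {Γ = (r *⁺ s , A) ∷ []} {(s *⁺ r , A) ∷ []}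
    (↭-reflexive (cong (λ t → (t , A) ∷ []) (*-comm (proj₁ r) (proj₁ s)))) (⨁-singleton r ss A)

  -- Both sides give `A` all products of a weight in `rs` and one in `ss`. Order and positivity
  -- proofs differ, hence `_≃_`.
  ⨁-swap : ∀ rs ss A → ⨁ rs (ss ∙ A) ≃ ⨁ ss (rs ∙ A)
  ⨁-swap [] ss A = ↭-reflexive (cong (map erase) (sym (⨁-[] ss)))
  ⨁-swap (r ∷ rs) ss A = ≃-trans {Δ = ⨁ ss ((r ∷ []) ∙ A) ++ ⨁ ss (rs ∙ A)}
    (≃-++ {Γ = scale r (ss ∙ A)} (⨁-singleton r ss A) (⨁-swap rs ss A))
    (↭⇒≃ (↭-sym (⨁-++ ss ((r ∷ []) ∙ A) (rs ∙ A))))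

  -- The multiples of `Γ` agree at once; those of `A` and of `B` agree by exchanging the order of
  -- summation.
  ⨁-redistribute : ∀ ps qs Γ A B →
    ⨁ (ps ++ qs) (Γ ++ ps ∙ A ++ qs ∙ B) ≃
    (⨁ ps (Γ ++ (ps ++ qs) ∙ A) ++ ⨁ qs (Γ ++ (ps ++ qs) ∙ B))
  ⨁-redistribute ps qs Γ A B =
    ≃-trans {Γ = ⨁ rs (Γ ++ ps ∙ A ++ qs ∙ B)} {Θ = ⨁ ps (Γ ++ rs ∙ A) ++ ⨁ qs (Γ ++ rs ∙ B)}
      (↭⇒≃ expand)
      (≃-trans {Γ = (⨁ ps Γ ++ ⨁ qs Γ) ++ ⨁ rs (ps ∙ A) ++ ⨁ rs (qs ∙ B)}
               {Θ = ⨁ ps (Γ ++ rs ∙ A) ++ ⨁ qs (Γ ++ rs ∙ B)}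
        (≃-++ {Γ = ⨁ ps Γ ++ ⨁ qs Γ} ↭-refl
          (≃-++ {Γ = ⨁ rs (ps ∙ A)} (⨁-swap rs ps A) (⨁-swap rs qs B)))
        (↭⇒≃ collect))
    where
    rs = ps ++ qs

    expand : ⨁ rs (Γ ++ ps ∙ A ++ qs ∙ B) ↭
             (⨁ ps Γ ++ ⨁ qs Γ) ++ ⨁ rs (ps ∙ A) ++ ⨁ rs (qs ∙ B)
    expand = ↭-trans (⨁-++ rs Γ (ps ∙ A ++ qs ∙ B))
      (++⁺ (↭-reflexive (concatMap-++ _ ps qs)) (⨁-++ rs (ps ∙ A) (qs ∙ B)))

    collect : (⨁ ps Γ ++ ⨁ qs Γ) ++ ⨁ ps (rs ∙ A) ++ ⨁ qs (rs ∙ B) ↭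
              ⨁ ps (Γ ++ rs ∙ A) ++ ⨁ qs (Γ ++ rs ∙ B)
    collect = ↭-trans
      (solve 4 (λ a b c d → (a ⊞ b) ⊞ (c ⊞ d) ⊜ (a ⊞ c) ⊞ (b ⊞ d)) ↭-refl
        (⨁ ps Γ) (⨁ qs Γ) (⨁ ps (rs ∙ A)) (⨁ qs (rs ∙ B)))
      (↭-sym (++⁺ (⨁-++ ps Γ (rs ∙ A)) (⨁-++ qs Γ (rs ∙ B))))

  ∙-++ : ∀ ps qs A → (ps ++ qs) ∙ A ≡ ps ∙ A ++ qs ∙ A
  ∙-++ ps qs A = map-++ _ ps qs

  -- If one list is empty, a hypothesis suffices. Otherwise the multiples of the sequent by all of
  -- `ps ++ qs` are summed, regrouped, and split into two nonempty sums of absorbed sequents.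
  Abs-mixed : ∀ {K} ps qs Γ {A B} → Abs K (Γ ++ (ps ++ qs) ∙ A) → Abs K (Γ ++ (ps ++ qs) ∙ B) →
              Abs K (Γ ++ ps ∙ A ++ qs ∙ B)
  Abs-mixed [] qs Γ a b = b
  Abs-mixed {K} ps@(_ ∷ _) [] Γ {A} a b = subst (λ Δ → Abs K (Γ ++ Δ)) (∙-++ ps [] A) a
  Abs-mixed ps@(p ∷ ps') qs@(q ∷ qs') Γ {A} {B} a b s d =
    Abs-++ (Abs-⨁ p ps' a) (Abs-⨁ q qs' b) s
      (resp-≃ {Γ = ⨁ (ps ++ qs) (Γ ++ ps ∙ A ++ qs ∙ B)} (⨁-redistribute ps qs Γ A B)
        (⨁-intro p (ps' ++ qs) d))

  D-mixed : ∀ {G} ps qs Γ {A B} → D (G ∣ Γ ++ (ps ++ qs) ∙ A) → D (G ∣ Γ ++ (ps ++ qs) ∙ B) →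
            D (G ∣ Γ ++ ps ∙ A ++ qs ∙ B)
  D-mixed [] qs Γ d e = e
  D-mixed {G} ps@(_ ∷ _) [] Γ {A} d e = subst (λ Δ → D (G ∣ Γ ++ Δ)) (∙-++ ps [] A) d
  D-mixed {G} ps@(p ∷ ps') qs@(q ∷ qs') Γ {A} {B} d e =
    -- The target is put in by weakening, so that the sum of its multiples can be contracted into
    -- it.
    Abs-⨁ p (ps' ++ qs) (Abs-∈ (last-∈ G)) (λ x → x)
      (struct s (resp-≃ {Γ = ⨁ ps (Γ ++ (ps ++ qs) ∙ A) ++ ⨁ qs (Γ ++ (ps ++ qs) ∙ B)}
        (↭-sym (⨁-redistribute ps qs Γ A B)) (M (⨁-intro p ps' d) (⨁-intro q qs' e))))
    where
    s : ∀ {Δ Θ} → (G ∣ Θ) ⊆ (G ∣ Δ ∣ Θ)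
    s = ∣-⊆ (⊆-∣ ∘ ⊆-∣) (last-∈ _)

  -- Reducing occurrences of formulas

  pick : {X : Set} → Bool → X → X → X
  pick i x y = if i then x else y

  ∙-↭ : ∀ {rs ss} A → rs ↭ ss → rs ∙ A ↭ ss ∙ A
  ∙-↭ A = map⁺ _

  ∙-↭-++ : ∀ {rs} ps qs A → rs ↭ ps ++ qs → rs ∙ A ↭ ps ∙ A ++ qs ∙ A
  ∙-↭-++ ps qs A p = ↭-trans (∙-↭ A p) (↭-reflexive (∙-++ ps qs A))

  -- Only equal choices are assumed; the unequal ones are mixed sequents, handled by `Abs-mixed`.
  Abs-pick : ∀ {K} ps qs Γ A B → (∀ i → Abs K (Γ ++ (ps ∙ pick i A B ++ qs ∙ pick i A B))) →
             ∀ i j → Abs K (Γ ++ (ps ∙ pick i A B ++ qs ∙ pick j A B))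
  Abs-pick {K} ps qs Γ A B a = λ
    { true true → a true
    ; true false → Abs-mixed ps qs Γ (joined true) (joined false)
    ; false true → Abs-↭ (++⁺ˡ Γ (++-comm (ps ∙ B) (qs ∙ A)))
        (Abs-mixed qs ps Γ (swapped true) (swapped false))
    ; false false → a false
    }
    where
    joined : ∀ i → Abs K (Γ ++ (ps ++ qs) ∙ pick i A B)
    joined i = subst (λ Δ → Abs K (Γ ++ Δ)) (sym (∙-++ ps qs _)) (a i)

    swapped : ∀ i → Abs K (Γ ++ (qs ++ ps) ∙ pick i A B)
    swapped i = Abs-↭ (++⁺ˡ Γ (∙-↭ _ (++-comm qs ps))) (joined i)

  -- Resolution on the pairs a and b: the combination of a i and b i is assumed absorbed, while
  -- that of a (not i) and b i need only be so in the presence of a i and b (not i).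
  resolve : ∀ {K} (a b : Bool → Seq) → D (K ∣ a true ∣ a false) → D (K ∣ b true ∣ b false) →
            (∀ i {L} → K ⊆ L → D (L ∣ a i) → D (L ∣ b i) → D L) →
            (∀ i {L} → K ⊆ L → a i ∈ L → b (not i) ∈ L → D (L ∣ a (not i)) → D (L ∣ b i) → D L) →
            D K
  resolve {K} a b d e diagonal exchange =
    -- `diagonal true` is used twice: with `d` and `cross false` it leaves `K ∣ a false`, with
    -- `cross true` and `e` it leaves `K ∣ b false`. `diagonal false` combines these.
    diagonal false (λ x → x)
      (diagonal true ⊆-∣ (pair a d false (⊆-∣ ∘ ⊆-∣) (⊆-∣ (last-∈ _)) (last-∈ _)) (cross false))
      (diagonal true ⊆-∣
        (struct (∣-⊆ (∣-⊆ (⊆-∣ ∘ ⊆-∣) (last-∈ _)) (⊆-∣ (last-∈ _))) (cross true))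
        (pair b e false (⊆-∣ ∘ ⊆-∣) (⊆-∣ (last-∈ _)) (last-∈ _)))
    where
    pair : ∀ (f : Bool → Seq) → D (K ∣ f true ∣ f false) →
           ∀ i {L} → K ⊆ L → f i ∈ L → f (not i) ∈ L → D L
    pair f d true s m n = struct (∣-⊆ (∣-⊆ s m) n) d
    pair f d false s m n = struct (∣-⊆ (∣-⊆ s n) m) d

    cross : ∀ i → D (K ∣ a i ∣ b (not i))
    -- With `a i` and `b (not i)` in the context, `d` and `e` have just `a (not i)` and `b i` left
    -- to eliminate.
    cross i = exchange i (⊆-∣ ∘ ⊆-∣) (⊆-∣ (last-∈ _)) (last-∈ _)
      (pair a d i (⊆-∣ ∘ ⊆-∣ ∘ ⊆-∣) (⊆-∣ (⊆-∣ (last-∈ _))) (last-∈ _))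
      (pair b e i (⊆-∣ ∘ ⊆-∣ ∘ ⊆-∣) (last-∈ _) (⊆-∣ (last-∈ _)))

  -- A step reduces one occurrence; only for A₀ ⊔ B₀ do the two components differ.
  -- c selects the conjunct kept of every A ⊓ B.
  module Reduction (A₀ B₀ : Term) (c : Bool) where

    data Step : WTerm → (Bool → Seq) → Set where
      keep  : ∀ {w} → Step w (λ _ → w ∷ [])
      zero  : ∀ {r} → Step (r , t0) (λ _ → [])
      plus  : ∀ {r A B} → Step (r , A ⊕ B) (λ _ → (r , A) ∷ (r , B) ∷ [])
      times : ∀ {r s A} → Step (r , s · A) (λ _ → (s *⁺ r , A) ∷ [])
      inf   : ∀ {r A B} → Step (r , A ⊓ B) (λ _ → (r , pick c A B) ∷ [])
      sup   : ∀ {r} → Step (r , A₀ ⊔ B₀) (λ i → (r , pick i A₀ B₀) ∷ [])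

    -- Occurrences are kept or reduced independently, since the induction tracks only the
    -- descendants of those reduced at the root. Reducts are compared at each index up to
    -- permutation.
    data Red : Seq → (Bool → Seq) → Set where
      nil  : ∀ {X} → (∀ i → X i ↭ []) → Red [] X
      cons : ∀ {w Γ Δ X Y} → Step w Δ → Red Γ X → (∀ i → Y i ↭ Δ i ++ X i) → Red (w ∷ Γ) Y

    Red-++⁺ : ∀ {Γ Δ X Y} → Red Γ X → Red Δ Y → Red (Γ ++ Δ) (λ i → X i ++ Y i)
    Red-++⁺ {Y = Y} (nil e) q = resp q (λ i → ++⁺ʳ (Y i) (e i))
      where
      resp : ∀ {Γ X Y} → Red Γ X → (∀ i → Y i ↭ X i) → Red Γ Y
      resp (nil e) e' = nil (λ i → ↭-trans (e' i) (e i))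
      resp (cons st p e) e' = cons st p (λ i → ↭-trans (e' i) (e i))
    Red-++⁺ {Y = Y} (cons {Δ = Δ} {X = X} st p e) q = cons st (Red-++⁺ p q)
      (λ i → ↭-trans (++⁺ʳ (Y i) (e i)) (↭-reflexive (++-assoc (Δ i) (X i) (Y i))))

    Red-refl : ∀ Γ → Red Γ (λ _ → Γ)
    Red-refl [] = nil (λ _ → ↭-refl)
    Red-refl (w ∷ Γ) = cons keep (Red-refl Γ) (λ _ → ↭-refl)

    Red-++⁻ : ∀ Γ {Δ X} → Red (Γ ++ Δ) X →
              ∃₂ λ Y Z → Red Γ Y × Red Δ Z × (∀ i → X i ↭ Y i ++ Z i)
    Red-++⁻ [] {X = X} p = (λ _ → []) , X , nil (λ _ → ↭-refl) , p , (λ _ → ↭-refl)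
    Red-++⁻ (w ∷ Γ) (cons {Δ = Δ} st p e) with Red-++⁻ Γ p
    ... | Y , Z , q₁ , q₂ , e' = (λ i → Δ i ++ Y i) , Z , cons st q₁ (λ _ → ↭-refl) , q₂ ,
      (λ i → ↭-trans (e i) (↭-trans (++⁺ˡ (Δ i) (e' i))
        (↭-reflexive (sym (++-assoc (Δ i) (Y i) (Z i))))))

    Red-↭ : ∀ {Γ Γ' X} → Γ ↭ Γ' → Red Γ' X → Red Γ X
    Red-↭ _↭_.refl q = q
    Red-↭ (prep w p) (cons st q e) = cons st (Red-↭ p q) e
    Red-↭ (swap v w p) (cons {Δ = Δ₁} st₁ (cons {Δ = Δ₂} {X = X} st₂ q e₂) e₁) =
      cons st₂ (cons st₁ (Red-↭ p q) (λ _ → ↭-refl))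
        (λ i → ↭-trans (e₁ i) (↭-trans (++⁺ˡ (Δ₁ i) (e₂ i)) (shifts (Δ₁ i) (Δ₂ i))))
    Red-↭ (_↭_.trans p₁ p₂) q = Red-↭ p₁ (Red-↭ p₂ q)

    -- For `s · A` the two sides have weights `s * (r * t)` and `r * (s * t)`, which agree only
    -- after `erase`.
    Step-scale : ∀ r {w Δ} → Step w Δ → ∃ λ Δ' → Step (r *⁺ proj₁ w , proj₂ w) Δ' ×
                 (∀ i → map erase (Δ' i) ≡ map erase (scale r (Δ i)))
    Step-scale r keep = _ , keep , λ _ → refl
    Step-scale r zero = _ , zero , λ _ → refl
    Step-scale r plus = _ , plus , λ _ → refl
    Step-scale r (times {t} {s} {A}) = _ , times , λ _ → cong (λ x → (x , A) ∷ [])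
      (trans (sym (*-assoc _ _ _))
        (trans (cong (_* proj₁ t) (*-comm (proj₁ s) (proj₁ r))) (*-assoc _ _ _)))
    Step-scale r inf = _ , inf , λ _ → refl
    Step-scale r sup = _ , sup , λ _ → refl

    Red-scale : ∀ r {Γ X} → Red Γ X → ∃ λ Y → Red (scale r Γ) Y × (∀ i → Y i ≃ scale r (X i))
    Red-scale r (nil e) = _ , nil (λ _ → ↭-refl) , λ i → ↭⇒≃ (map⁺ _ (↭-sym (e i)))
    Red-scale r (cons {Δ = Δ} {X = X} {Y = Z} st p e) with Step-scale r st | Red-scale r p
    ... | Δ' , st' , eq | Y , q , f = (λ i → Δ' i ++ Y i) , cons st' q (λ _ → ↭-refl) , λ i →
      ≃-trans {Γ = Δ' i ++ Y i} {Θ = scale r (Z i)} (≃-++ {Γ = Δ' i} (↭-reflexive (eq i)) (f i))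
        (↭⇒≃ (↭-trans (↭-reflexive (sym (map-++ _ (Δ i) (X i)))) (map⁺ _ (↭-sym (e i)))))

    -- Holds of variables, units and ◇-formulas, to which only `keep` applies; thus `ID`, `R1` and
    -- `R◇` find their formulas unchanged.
    Inert : WTerm → Set
    Inert w = ∀ {Δ} → Step w Δ → ∀ i → Δ i ≡ w ∷ []

    inert⁻ : ∀ {Γ X} → All Inert Γ → Red Γ X → ∀ i → X i ↭ Γ
    inert⁻ [] (nil e) = e
    inert⁻ (h ∷ hs) (cons {X = X} st p e) i =
      ↭-trans (e i) (++⁺ (↭-reflexive (h st i)) (inert⁻ hs p i))

    ∙-inert : ∀ rs {A} → (∀ r → Inert (r , A)) → All Inert (rs ∙ A)
    ∙-inert rs h = AllP.map⁺ (All.universal h rs)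

    -- Only `sup` depends on the index, so both components share `Γ₀` and differ in the reduced
    -- occurrences of `A₀ ⊔ B₀` alone. `Abs-pick` requires this form.
    shape : ∀ {Γ X} → Red Γ X → ∃₂ λ Γ₀ ps → ∀ i → X i ↭ Γ₀ ++ ps ∙ pick i A₀ B₀
    shape (nil e) = [] , [] , e
    shape (cons {Δ = Δ} {X = X} st p e) with step-shape st | shape p
      where
      step-shape : ∀ {w Δ} → Step w Δ → ∃₂ λ Γ₀ ps → ∀ i → Δ i ↭ Γ₀ ++ ps ∙ pick i A₀ B₀
      step-shape (keep {w}) = w ∷ [] , [] , λ _ → ↭-refl
      step-shape zero = [] , [] , λ _ → ↭-refl
      step-shape (plus {r} {A} {B}) = (r , A) ∷ (r , B) ∷ [] , [] , λ _ → ↭-refl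
      step-shape (times {r} {s} {A}) = (s *⁺ r , A) ∷ [] , [] , λ _ → ↭-refl
      step-shape (inf {r} {A} {B}) = (r , pick c A B) ∷ [] , [] , λ _ → ↭-refl
      step-shape (sup {r}) = [] , r ∷ [] , λ _ → ↭-refl
    ... | Γ₁ , ps₁ , e₁ | Γ₂ , ps₂ , e₂ = Γ₁ ++ Γ₂ , ps₁ ++ ps₂ , λ i →
      ↭-trans (e i) (↭-trans (++⁺ (e₁ i) (e₂ i))
        (↭-trans (solve 4 (λ a b c d → (a ⊞ b) ⊞ (c ⊞ d) ⊜ (a ⊞ c) ⊞ (b ⊞ d)) ↭-refl
          Γ₁ (ps₁ ∙ pick i A₀ B₀) Γ₂ (ps₂ ∙ pick i A₀ B₀))
        (++⁺ˡ (Γ₁ ++ Γ₂) (↭-reflexive (sym (∙-++ ps₁ ps₂ _))))))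

    -- The occurrences split into kept ones `ks` and reduced ones `ms`, with `F ms` as reduct. `E`
    -- records what a genuine reduction reveals about `A`: for ⊔, that it is `A₀ ⊔ B₀`.
    principal⁻ : ∀ {A} (E : Set) (F : List ℝ⁺ → Bool → Seq) → (∀ i → F [] i ≡ []) →
      (∀ {r Δ} → Step (r , A) Δ → (∀ i → Δ i ≡ (r , A) ∷ []) ⊎
                                  (E × (∀ rs i → Δ i ++ F rs i ↭ F (r ∷ rs) i))) →
      ∀ rs {X} → Red (rs ∙ A) X →
      ∃₂ λ ks ms → rs ↭ ks ++ ms × (ms ≡ [] ⊎ E) × (∀ i → X i ↭ ks ∙ A ++ F ms i)
    principal⁻ E F F[] h [] (nil e) =
      [] , [] , ↭-refl , inj₁ refl , λ i → ↭-trans (e i) (↭-reflexive (sym (F[] i)))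
    principal⁻ {A} E F F[] h (r ∷ rs) (cons {Δ = Δ} st p e) with h st | principal⁻ E F F[] h rs p
    ... | inj₁ k | ks , ms , q , E? , f = r ∷ ks , ms , prep r q , E? ,
      λ i → ↭-trans (e i) (++⁺ (↭-reflexive (k i)) (f i))
    ... | inj₂ (x , k) | ks , ms , q , E? , f =
      ks , r ∷ ms , ↭-trans (prep r q) (↭-sym (shift r ks ms)) , inj₂ x , λ i →
      ↭-trans (e i) (↭-trans (++⁺ˡ (Δ i) (f i))
        (↭-trans (shifts (Δ i) (ks ∙ A)) (++⁺ˡ (ks ∙ A) (k ms i))))

    -- Reduction as a simulation.

    Reducible : HS → Seq → Set
    Reducible K Γ = ∃ λ X → Red Γ X × (∀ i → Abs K (X i))

    private
      reducible-inert⁻ : ∀ {K} Γ {Θ} → All Inert Θ → Reducible K (Γ ++ Θ) →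
                     ∃ λ X → Red Γ X × (∀ i → Abs K (X i ++ Θ))
      reducible-inert⁻ Γ h (_ , p , a) with Red-++⁻ Γ p
      ... | Y , Z , q₁ , q₂ , e =
        Y , q₁ , λ i → Abs-↭ (↭-sym (↭-trans (e i) (++⁺ˡ (Y i) (inert⁻ h q₂ i)))) (a i)

      -- The kept occurrences move to the end, where the rule for `A` is reapplied to them alone;
      -- the reduced ones already look as in a premise.
      reducible⁻ : ∀ {K} Γ rs {A} (E : Set) (F : List ℝ⁺ → Bool → Seq) → (∀ i → F [] i ≡ []) →
        (∀ {r Δ} → Step (r , A) Δ → (∀ i → Δ i ≡ (r , A) ∷ []) ⊎
                                    (E × (∀ rs i → Δ i ++ F rs i ↭ F (r ∷ rs) i))) →
        Reducible K (Γ ++ rs ∙ A) →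
        ∃ λ X → ∃₂ λ ks ms → Red Γ X × rs ↭ ks ++ ms × (ms ≡ [] ⊎ E) ×
        (∀ i → Abs K ((X i ++ F ms i) ++ ks ∙ A))
      reducible⁻ Γ rs {A} E F F[] h (_ , p , a) with Red-++⁻ Γ p
      ... | Y , Z , q₁ , q₂ , e with principal⁻ E F F[] h rs q₂
      ... | ks , ms , r , E? , f = Y , ks , ms , q₁ , r , E? , λ i → Abs-↭ (↭-sym
        (↭-trans (e i) (↭-trans (++⁺ˡ (Y i) (↭-trans (f i) (++-comm (ks ∙ A) (F ms i))))
          (↭-reflexive (sym (++-assoc (Y i) (F ms i) (ks ∙ A))))))) (a i)

      pair : ∀ {L} {X : Bool → Seq} → ∀ i → Abs (L ∣ X true ∣ X false) (X i)
      pair true = Abs-∈ (⊆-∣ (last-∈ _))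
      pair false = Abs-∈ (last-∈ _)

    Reducible-simulation : Simulation Reducible
    Reducible-simulation = record
      { mono = λ { s (_ , q , a) → _ , q , λ i → Abs-mono s (a i) }
      ; perm = λ { p (_ , q , a) → _ , Red-↭ p q , a }
      ; init = λ { (_ , nil e , a) → Abs-single (Abs-↭ (↭-sym (e true)) (a true)) INIT }
      ; split = λ { (_ , q₁ , a₁) (_ , q₂ , a₂) → _ , Red-++⁺ q₁ q₂ , λ i → Abs-++ (a₁ i) (a₂ i) }
      ; mix = mix'
      ; mult = mult'
      ; axm = axm'
      ; zer = zer'
      ; plus = plus'
      ; times = times'
      ; sup = sup'
      ; inf = inf'
      ; one = one'
      ; dia = dia'
      }
      where
      mult' : ∀ {K Γ} r → Reducible K Γ → Reducible K (scale r Γ)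
      mult' r (_ , q , a) with Red-scale r q
      ... | _ , q' , e = _ , q' , λ i → Abs-lift (resp-≃ (e i)) (Abs-scale r (a i))

      mix' : ∀ {K} Γ₁ Γ₂ → Reducible K (Γ₁ ++ Γ₂) → (∀ {L} → K ⊆ L → Reducible L Γ₁ → D L) →
             (∀ {L} → K ⊆ L → Reducible L Γ₂ → D L) → D K
      mix' {K} Γ₁ Γ₂ (_ , p , a) d₁ d₂ with Red-++⁻ Γ₁ p
      ... | X , Y , q₁ , q₂ , e with shape q₁ | shape q₂
      ... | Θ₁ , ps , f₁ | Θ₂ , qs , f₂ =
        -- Replaying a premise needs both of its reducts absorbed, so both are added to `K`. Every
        -- combination of `X i` with `Y j` is absorbed, and `resolve` removes the additions.
        resolve X Y (d₁ (⊆-∣ ∘ ⊆-∣) (X , q₁ , pair)) (d₂ (⊆-∣ ∘ ⊆-∣) (Y , q₂ , pair))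
          (λ i s x y → absorb i i s (M x y)) (λ i s _ _ x y → absorb (not i) i s (M x y))
        where
        rearrange : ∀ i j → X i ++ Y j ↭ (Θ₁ ++ Θ₂) ++ ps ∙ pick i A₀ B₀ ++ qs ∙ pick j A₀ B₀
        rearrange i j = ↭-trans (++⁺ (f₁ i) (f₂ j))
          (solve 4 (λ a b c d → (a ⊞ b) ⊞ (c ⊞ d) ⊜ (a ⊞ c) ⊞ (b ⊞ d)) ↭-refl
            Θ₁ (ps ∙ pick i A₀ B₀) Θ₂ (qs ∙ pick j A₀ B₀))

        absorb : ∀ i j → Abs K (X i ++ Y j)
        absorb i j = Abs-↭ (rearrange i j) (Abs-pick ps qs (Θ₁ ++ Θ₂) A₀ B₀
          (λ i → Abs-↭ (↭-sym (↭-trans (e i) (rearrange i i))) (a i)) i j)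

      axm' : ∀ {K} Γ rs ss {x} → ∑ rs ≡ ∑ ss →
             Reducible K (Γ ++ rs ∙ var x ++ ss ∙ covar x) → Reducible K Γ
      axm' Γ rs ss eq p with reducible-inert⁻ Γ (AllP.++⁺ (∙-inert rs λ { _ keep _ → refl })
                                                      (∙-inert ss λ { _ keep _ → refl })) p
      ... | _ , q , a = _ , q , λ i → Abs-lift (ID {rs = rs} {ss = ss} _ eq) (a i)

      one' : ∀ {K} Γ rs ss → ∑ ss ≤ ∑ rs → Reducible K (Γ ++ rs ∙ t1 ++ ss ∙ t1̄) → Reducible K Γ
      one' Γ rs ss le p with reducible-inert⁻ Γ (AllP.++⁺ (∙-inert rs λ { _ keep _ → refl })
                                                      (∙-inert ss λ { _ keep _ → refl })) p
      ... | _ , q , a = _ , q , λ i → Abs-lift (R1 {rs = rs} {ss = ss} le) (a i)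

      dia' : ∀ {K} Γ rs ss → ∑ ss ≤ ∑ rs → Reducible K (◇s Γ ++ rs ∙ t1 ++ ss ∙ t1̄) →
             D ([] ∣ Γ ++ rs ∙ t1 ++ ss ∙ t1̄) →
             (∀ {L} → Reducible L (Γ ++ rs ∙ t1 ++ ss ∙ t1̄) → D L) → D K
      -- A conclusion of ◇ is inert throughout, so it is its own reduct, and `R◇` is reapplied to
      -- the given premise derivation.
      dia' Γ rs ss le (_ , p , a) d _ = Abs-single
        (Abs-↭ (↭-sym (inert⁻ (AllP.++⁺ (AllP.map⁺ (All.universal (λ { _ keep _ → refl }) Γ))
          (AllP.++⁺ (∙-inert rs λ { _ keep _ → refl }) (∙-inert ss λ { _ keep _ → refl }))) p true))
          (a true))
        (R◇ {Γ = Γ} {rs = rs} {ss = ss} le d)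

      zer' : ∀ {K} Γ rs → Reducible K (Γ ++ rs ∙ t0) → Reducible K Γ
      zer' Γ rs p with reducible⁻ Γ rs ⊤ (λ _ _ → []) (λ _ → refl)
        (λ { keep → inj₁ (λ _ → refl) ; zero → inj₂ (tt , λ _ _ → ↭-refl) }) p
      ... | X , ks , ms , q , _ , _ , a = X , q , λ i →
        Abs-↭ (↭-reflexive (sym (++-identityʳ (X i)))) (Abs-lift (R0 {rs = ks}) (a i))

      plus' : ∀ {K} Γ rs {A B} → Reducible K (Γ ++ rs ∙ (A ⊕ B)) →
              Reducible K (Γ ++ rs ∙ A ++ rs ∙ B)
      plus' Γ rs {A} {B} p with reducible⁻ Γ rs ⊤ (λ ms _ → ms ∙ A ++ ms ∙ B) (λ _ → refl)
        (λ { keep → inj₁ (λ _ → refl)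
           ; plus → inj₂ (tt , λ ms _ → prep _ (↭-sym (shift _ (ms ∙ A) (ms ∙ B)))) }) p
      ... | X , ks , ms , q , r , _ , a = _ , Red-++⁺ q (Red-refl _) , λ i →
        Abs-↭ (rearrange (X i)) (Abs-lift (R+ {Γ = X i ++ ms ∙ A ++ ms ∙ B} {rs = ks}) (a i))
        where
        rearrange : ∀ Θ → Θ ++ rs ∙ A ++ rs ∙ B ↭ (Θ ++ ms ∙ A ++ ms ∙ B) ++ ks ∙ A ++ ks ∙ B
        rearrange Θ = ↭-trans (++⁺ˡ Θ (++⁺ (∙-↭-++ ks ms A r) (∙-↭-++ ks ms B r)))
          (solve 5 (λ θ a b c d → θ ⊞ (a ⊞ b) ⊞ (c ⊞ d) ⊜ (θ ⊞ b ⊞ d) ⊞ (a ⊞ c)) ↭-refl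
            Θ (ks ∙ A) (ms ∙ A) (ks ∙ B) (ms ∙ B))

      times' : ∀ {K} Γ rs {A} s → Reducible K (Γ ++ rs ∙ (s · A)) →
               Reducible K (Γ ++ (s ⋆ rs) ∙ A)
      times' Γ rs {A} s p with reducible⁻ Γ rs ⊤ (λ ms _ → (s ⋆ ms) ∙ A) (λ _ → refl)
        (λ { keep → inj₁ (λ _ → refl) ; times → inj₂ (tt , λ _ _ → ↭-refl) }) p
      ... | X , ks , ms , q , r , _ , a = _ , Red-++⁺ q (Red-refl _) , λ i →
        Abs-↭ (rearrange (X i)) (Abs-lift (R× {Γ = X i ++ (s ⋆ ms) ∙ A} {rs = ks} s) (a i))
        where
        rearrange : ∀ Θ → Θ ++ (s ⋆ rs) ∙ A ↭ (Θ ++ (s ⋆ ms) ∙ A) ++ (s ⋆ ks) ∙ A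
        rearrange Θ = ↭-trans (++⁺ˡ Θ (∙-↭-++ (s ⋆ ks) (s ⋆ ms) A
            (↭-trans (map⁺ (s *⁺_) r) (↭-reflexive (map-++ (s *⁺_) ks ms)))))
          (solve 3 (λ θ a b → θ ⊞ a ⊞ b ⊜ (θ ⊞ b) ⊞ a) ↭-refl Θ ((s ⋆ ks) ∙ A) ((s ⋆ ms) ∙ A))

      regroup : ∀ {rs ks ms} Θ A → rs ↭ ks ++ ms → (Θ ++ ms ∙ A) ++ ks ∙ A ↭ Θ ++ rs ∙ A
      regroup {rs} {ks} {ms} Θ A r = ↭-trans
        (solve 3 (λ θ a b → (θ ⊞ b) ⊞ a ⊜ θ ⊞ a ⊞ b) ↭-refl Θ (ks ∙ A) (ms ∙ A))
        (++⁺ˡ Θ (↭-sym (∙-↭-++ ks ms A r)))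

      sup' : ∀ {K} Γ rs {A B} → Reducible K (Γ ++ rs ∙ (A ⊔ B)) →
             Reducible K (Γ ++ rs ∙ A) × Reducible K (Γ ++ rs ∙ B)
      sup' {K} Γ rs {A} {B} p with reducible⁻ Γ rs (A ≡ A₀ × B ≡ B₀)
        (λ ms i → ms ∙ pick i A B) (λ _ → refl)
        (λ { keep → inj₁ (λ _ → refl) ; sup → inj₂ ((refl , refl) , λ _ _ → ↭-refl) }) p
      ... | X , ks , .[] , q , r , inj₁ refl , a =
        (_ , Red-++⁺ q (Red-refl _) , λ i → Abs-↭ (↭-sym (regroup (X i) A r))
          (proj₁ (Abs-⊔ {rs = ks} (X i ++ []) (a i)))) ,
        (_ , Red-++⁺ q (Red-refl _) , λ i → Abs-↭ (↭-sym (regroup (X i) B r))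
          (proj₂ (Abs-⊔ {rs = ks} (X i ++ []) (a i))))
      ... | X , ks , ms , q , r , inj₂ (refl , refl) , a with shape q
      -- A premise fixes one disjunct on `rs` at both indices, while `X i` still varies with `i`.
      -- `combine` absorbs the resulting mismatches, starting from the equal choices in `diagonal`.
      ... | Θ , ps , f = (_ , Red-++⁺ q (Red-refl _) , λ i → combine i true) ,
                         (_ , Red-++⁺ q (Red-refl _) , λ i → combine i false)
        where
        rearrange : ∀ i j → X i ++ rs ∙ pick j A B ↭ Θ ++ (ps ∙ pick i A B ++ rs ∙ pick j A B)
        rearrange i j = ↭-trans (++⁺ʳ (rs ∙ pick j A B) (f i))
          (↭-reflexive (++-assoc Θ (ps ∙ pick i A B) (rs ∙ pick j A B)))

        diagonal : ∀ i → Abs K (X i ++ rs ∙ pick i A B)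
        diagonal true = Abs-↭ (↭-sym (regroup (X true) A r))
          (proj₁ (Abs-⊔ {rs = ks} (X true ++ ms ∙ A) (a true)))
        diagonal false = Abs-↭ (↭-sym (regroup (X false) B r))
          (proj₂ (Abs-⊔ {rs = ks} (X false ++ ms ∙ B) (a false)))

        combine : ∀ i j → Abs K (X i ++ rs ∙ pick j A B)
        combine i j = Abs-↭ (rearrange i j) (Abs-pick ps rs Θ A B
          (λ i → Abs-↭ (↭-sym (rearrange i i)) (diagonal i)) i j)

      inf' : ∀ {K} Γ rs {A B} → Reducible K (Γ ++ rs ∙ (A ⊓ B)) →
             (∀ {L} → K ⊆ L → Reducible L (Γ ++ rs ∙ A) → D L) →
             (∀ {L} → K ⊆ L → Reducible L (Γ ++ rs ∙ B) → D L) → D K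
      inf' {K} Γ rs {A} {B} p d₁ d₂ with reducible⁻ Γ rs ⊤
        (λ ms _ → ms ∙ pick c A B) (λ _ → refl)
        (λ { keep → inj₁ (λ _ → refl) ; inf → inj₂ (tt , λ _ _ → ↭-refl) }) p
      ... | X , ks , ms , q , r , _ , a =
        resolve (λ i → X i ++ rs ∙ A) (λ i → X i ++ rs ∙ B)
          (d₁ (⊆-∣ ∘ ⊆-∣) (_ , Red-++⁺ q (Red-refl _) , pair))
          (d₂ (⊆-∣ ∘ ⊆-∣) (_ , Red-++⁺ q (Red-refl _) , pair))
          -- `R⊓` rebuilds the kept `ks`, while the reduced `ms` show conjunct `c` in both premises;
          -- where the two disagree, `mixed` appeals to `D-mixed`.
          (λ i s x y → a i s (R⊓ {Γ = X i ++ ms ∙ pick c A B} {rs = ks}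
            (mixed (X i) c true x y) (mixed (X i) c false x y)))
          -- Swapping the conjuncts between the halves after `M` lets `S` produce two sequents
          -- already in the context, which are contracted.
          (λ i s m n x y → contract m (contract (⊆-∣ n)
            (struct (∣-⊆ (∣-⊆ (⊆-∣ ∘ ⊆-∣) (last-∈ _)) (⊆-∣ (last-∈ _)))
              (S {Γ₁ = X (not i) ++ rs ∙ B} {Γ₂ = X i ++ rs ∙ A} (resp-↭ₛ (exchange i) (M x y))))))
        where
        exchange : ∀ i → (X (not i) ++ rs ∙ A) ++ (X i ++ rs ∙ B) ↭
                         (X (not i) ++ rs ∙ B) ++ (X i ++ rs ∙ A)
        exchange i = solve 4 (λ x a y b → (x ⊞ a) ⊞ (y ⊞ b) ⊜ (x ⊞ b) ⊞ (y ⊞ a)) ↭-refl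
          (X (not i)) (rs ∙ A) (X i) (rs ∙ B)

        joined : ∀ {G ss} Θ {A} → rs ↭ ss → D (G ∣ Θ ++ rs ∙ A) → D (G ∣ Θ ++ ss ∙ A)
        joined Θ r = resp-↭ₛ (++⁺ˡ Θ (∙-↭ _ r))

        mixed : ∀ {G} Θ j l → D (G ∣ Θ ++ rs ∙ A) → D (G ∣ Θ ++ rs ∙ B) →
                D (G ∣ (Θ ++ ms ∙ pick j A B) ++ ks ∙ pick l A B)
        mixed Θ true true x y = resp-↭ₛ (↭-sym (regroup Θ A r)) x
        mixed Θ false false x y = resp-↭ₛ (↭-sym (regroup Θ B r)) y
        mixed Θ true false x y = resp-↭ₛ (↭-reflexive (sym (++-assoc Θ _ _)))
          (D-mixed ms ks Θ (joined Θ r' x) (joined Θ r' y))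
          where r' = ↭-trans r (++-comm ks ms)
        mixed Θ false true x y = resp-↭ₛ
          (solve 3 (λ θ a b → θ ⊞ a ⊞ b ⊜ (θ ⊞ b) ⊞ a) ↭-refl Θ (ks ∙ A) (ms ∙ B))
          (D-mixed ks ms Θ (joined Θ r x) (joined Θ r y))

    reduce : ∀ {G K Γ Δ X} → G ⊆ K → Red Δ X → (∀ i → Γ ++ X i ∈ K) → D (G ∣ Γ ++ Δ) → D K
    reduce {Γ = Γ} s q m d = simulate Reducible-simulation d (AllP.∷ʳ⁺
      (All.tabulate λ x → _ , Red-refl _ , λ _ → Abs-∈ (s x))
      (_ , Red-++⁺ (Red-refl Γ) q , λ i → Abs-∈ (m i)))

    Red-∙ : ∀ {A} {F : List ℝ⁺ → Bool → Seq} → (∀ i → F [] i ≡ []) →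
            (∀ r → ∃ λ Δ → Step (r , A) Δ × (∀ rs i → F (r ∷ rs) i ↭ Δ i ++ F rs i)) →
            ∀ rs → Red (rs ∙ A) (F rs)
    Red-∙ e h [] = nil (λ i → ↭-reflexive (e i))
    Red-∙ e h (r ∷ rs) with h r
    ... | _ , st , f = cons st (Red-∙ e h rs) (f rs)

  -- Invertibility of ◇

  module Unboxing where

    -- Read upwards, this class of formulas persists until a ◇ rule is met: besides structural
    -- rules, only `R1` and `R◇` can have principal formulas in it.
    data Modal : Term → Set where
      one   : Modal t1
      coone : Modal t1̄
      box   : ∀ {A} → Modal (◇ A)

    unbox : Term → Term
    unbox (◇ A) = A
    unbox A = A

    unboxₛ : Seq → Seq
    unboxₛ = map (λ w → proj₁ w , unbox (proj₂ w))

    unboxₛ-◇s : ∀ Γ → unboxₛ (◇s Γ) ≡ Γ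
    unboxₛ-◇s [] = refl
    unboxₛ-◇s (w ∷ Γ) = cong (w ∷_) (unboxₛ-◇s Γ)

    unboxₛ-units : ∀ rs ss → unboxₛ (rs ∙ t1 ++ ss ∙ t1̄) ≡ rs ∙ t1 ++ ss ∙ t1̄
    unboxₛ-units (r ∷ rs) ss = cong ((r , t1) ∷_) (unboxₛ-units rs ss)
    unboxₛ-units [] [] = refl
    unboxₛ-units [] (s ∷ ss) = cong ((s , t1̄) ∷_) (unboxₛ-units [] ss)

    unboxₛ-scale : ∀ r Γ → unboxₛ (scale r Γ) ≡ scale r (unboxₛ Γ)
    unboxₛ-scale r [] = refl
    unboxₛ-scale r (w ∷ Γ) = cong (_ ∷_) (unboxₛ-scale r Γ)

    ModalSeq : Seq → Set
    ModalSeq = All (Modal ∘ proj₂)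

    Unboxable : HS → Seq → Set
    Unboxable K Γ = ModalSeq Γ × Abs K (unboxₛ Γ)

    private
      -- The calculus allows empty lists of principal formulas, so the other logical rules may still
      -- occur, but only vacuously.
      no-principal : ∀ Γ rs {A} → (Modal A → ⊥) → ModalSeq (Γ ++ rs ∙ A) → rs ≡ []
      no-principal Γ [] h m = refl
      no-principal Γ (r ∷ rs) h m with AllP.++⁻ʳ Γ m
      ... | x ∷ _ = ⊥-elim (h x)

      drop-[] : ∀ {K} Γ → Unboxable K (Γ ++ []) → Unboxable K Γ
      drop-[] {K} Γ = subst (Unboxable K) (++-identityʳ Γ)

    Unboxable-simulation : Simulation Unboxable
    Unboxable-simulation = record
      { mono = λ { s (m , a) → m , Abs-mono s a }
      ; perm = λ { p (m , a) → All-resp-↭ (↭-sym p) m , Abs-↭ (map⁺ _ p) a }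
      ; init = λ { (_ , a) → Abs-single a INIT }
      ; split = λ { {K} {Γ₁} {Γ₂} (m₁ , a₁) (m₂ , a₂) →
          AllP.++⁺ m₁ m₂ , subst (Abs K) (sym (map-++ _ Γ₁ Γ₂)) (Abs-++ a₁ a₂) }
      ; mix = mix'
      ; mult = λ { {K} {Γ} r (m , a) →
          AllP.map⁺ (All.map (λ x → x) m) , subst (Abs K) (sym (unboxₛ-scale r Γ)) (Abs-scale r a) }
      ; axm = axm'
      ; zer = zer'
      ; plus = plus'
      ; times = times'
      ; sup = sup'
      ; inf = inf'
      ; one = one'
      ; dia = dia'
      }
      where
      mix' : ∀ {K} Γ₁ Γ₂ → Unboxable K (Γ₁ ++ Γ₂) → (∀ {L} → K ⊆ L → Unboxable L Γ₁ → D L) →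
             (∀ {L} → K ⊆ L → Unboxable L Γ₂ → D L) → D K
      mix' {K} Γ₁ Γ₂ (m , a) d e with AllP.++⁻ Γ₁ m
      ... | m₁ , m₂ = subst (Abs K) (map-++ _ Γ₁ Γ₂) a (λ x → x)
        (M (d ⊆-∣ (m₁ , Abs-∈ (last-∈ K))) (e ⊆-∣ (m₂ , Abs-∈ (last-∈ K))))

      axm' : ∀ {K} Γ rs ss {x} → ∑ rs ≡ ∑ ss →
             Unboxable K (Γ ++ rs ∙ var x ++ ss ∙ covar x) → Unboxable K Γ
      axm' Γ (r ∷ rs) ss eq (m , _) with AllP.++⁻ʳ Γ m
      ... | () ∷ _
      axm' Γ [] ss eq p with no-principal Γ ss (λ ()) (proj₁ p)
      ... | refl = drop-[] Γ p

      zer' : ∀ {K} Γ rs → Unboxable K (Γ ++ rs ∙ t0) → Unboxable K Γ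
      zer' Γ rs p with no-principal Γ rs (λ ()) (proj₁ p)
      ... | refl = drop-[] Γ p

      plus' : ∀ {K} Γ rs {A B} → Unboxable K (Γ ++ rs ∙ (A ⊕ B)) →
              Unboxable K (Γ ++ rs ∙ A ++ rs ∙ B)
      plus' Γ rs p with no-principal Γ rs (λ ()) (proj₁ p)
      ... | refl = p

      times' : ∀ {K} Γ rs {A} s → Unboxable K (Γ ++ rs ∙ (s · A)) →
               Unboxable K (Γ ++ (s ⋆ rs) ∙ A)
      times' Γ rs s p with no-principal Γ rs (λ ()) (proj₁ p)
      ... | refl = p

      sup' : ∀ {K} Γ rs {A B} → Unboxable K (Γ ++ rs ∙ (A ⊔ B)) →
             Unboxable K (Γ ++ rs ∙ A) × Unboxable K (Γ ++ rs ∙ B)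
      sup' Γ rs p with no-principal Γ rs (λ ()) (proj₁ p)
      ... | refl = p , p

      inf' : ∀ {K} Γ rs {A B} → Unboxable K (Γ ++ rs ∙ (A ⊓ B)) →
             (∀ {L} → K ⊆ L → Unboxable L (Γ ++ rs ∙ A) → D L) →
             (∀ {L} → K ⊆ L → Unboxable L (Γ ++ rs ∙ B) → D L) → D K
      inf' Γ rs p d _ with no-principal Γ rs (λ ()) (proj₁ p)
      ... | refl = d (λ x → x) p

      one' : ∀ {K} Γ rs ss → ∑ ss ≤ ∑ rs → Unboxable K (Γ ++ rs ∙ t1 ++ ss ∙ t1̄) → Unboxable K Γ
      one' {K} Γ rs ss le (m , a) = AllP.++⁻ˡ Γ m , Abs-lift (R1 {rs = rs} {ss = ss} le)
        (subst (Abs K) (trans (map-++ _ Γ _) (cong (unboxₛ Γ ++_) (unboxₛ-units rs ss))) a)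

      dia' : ∀ {K} Γ rs ss → ∑ ss ≤ ∑ rs → Unboxable K (◇s Γ ++ rs ∙ t1 ++ ss ∙ t1̄) →
             D ([] ∣ Γ ++ rs ∙ t1 ++ ss ∙ t1̄) →
             (∀ {L} → Unboxable L (Γ ++ rs ∙ t1 ++ ss ∙ t1̄) → D L) → D K
      -- Unboxing the conclusion of ◇ yields exactly its premise, so the premise derivation closes
      -- the branch.
      dia' {K} Γ rs ss le (_ , a) d _ = Abs-single (subst (Abs K)
        (trans (map-++ _ (◇s Γ) _) (cong₂ _++_ (unboxₛ-◇s Γ) (unboxₛ-units rs ss))) a) d

    ◇-invertible : ∀ Γ rs ss →
                   D ([] ∣ ◇s Γ ++ rs ∙ t1 ++ ss ∙ t1̄) → D ([] ∣ Γ ++ rs ∙ t1 ++ ss ∙ t1̄)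
    ◇-invertible Γ rs ss d = simulate Unboxable-simulation d ((modal , Abs-∈ (here unboxed)) ∷ [])
      where
      modal : ModalSeq (◇s Γ ++ rs ∙ t1 ++ ss ∙ t1̄)
      modal = AllP.++⁺ (AllP.map⁺ (All.universal (λ _ → box) Γ))
        (AllP.++⁺ (AllP.map⁺ (All.universal (λ _ → one) rs))
          (AllP.map⁺ (All.universal (λ _ → coone) ss)))

      unboxed : unboxₛ (◇s Γ ++ rs ∙ t1 ++ ss ∙ t1̄) ≡ Γ ++ rs ∙ t1 ++ ss ∙ t1̄
      unboxed = trans (map-++ _ (◇s Γ) _) (cong₂ _++_ (unboxₛ-◇s Γ) (unboxₛ-units rs ss))

  -- Invertibility, rule by rule.

  invertible : ∀ {concl premises} → LogicalInstance concl premises → D concl → All D premises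
  invertible (i0 G Γ rs) d = reduce ⊆-∣
    (Red-∙ {F = λ _ _ → []} (λ _ → refl) (λ _ → _ , zero , λ _ _ → ↭-refl) rs)
    (λ _ → subst (_∈ (G ∣ Γ)) (sym (++-identityʳ Γ)) (last-∈ G)) d ∷ []
    -- Default parameters: only steps on ⊔ and ⊓ are governed by them, and the occurrences reduced
    -- here are of `t0`.
    where open Reduction t0 t0 true
  invertible (i+ G Γ rs A B) d = reduce ⊆-∣
    (Red-∙ {F = λ rs _ → rs ∙ A ++ rs ∙ B} (λ _ → refl)
      (λ r → _ , plus , λ rs _ → prep _ (shift _ (rs ∙ A) (rs ∙ B))) rs)
    (λ _ → last-∈ G) d ∷ []
    where open Reduction t0 t0 true
  invertible (i× G Γ rs A s) d = reduce ⊆-∣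
    (Red-∙ {F = λ rs _ → (s ⋆ rs) ∙ A} (λ _ → refl) (λ r → _ , times , λ _ _ → ↭-refl) rs)
    (λ _ → last-∈ G) d ∷ []
    where open Reduction t0 t0 true
  invertible (i⊔ G Γ rs A B) d = reduce (⊆-∣ ∘ ⊆-∣)
    (Red-∙ {F = λ rs i → rs ∙ pick i A B} (λ _ → refl) (λ r → _ , sup , λ _ _ → ↭-refl) rs)
    (λ { true → ⊆-∣ (last-∈ G) ; false → last-∈ (G ∣ Γ ++ rs ∙ A) }) d ∷ []
    where open Reduction A B true
  -- A reduction keeps the same conjunct everywhere, so each premise takes a separate run.
  invertible (i⊓ G Γ rs A B) d = choose true ∷ choose false ∷ []
    where
    choose : ∀ c → D (G ∣ Γ ++ rs ∙ pick c A B)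
    choose c = reduce ⊆-∣
      (Red-∙ {F = λ rs _ → rs ∙ pick c A B} (λ _ → refl) (λ r → _ , inf , λ _ _ → ↭-refl) rs)
      (λ _ → last-∈ G) d
      where open Reduction t0 t0 c
  invertible (i◇ Γ rs ss _) d = Unboxing.◇-invertible Γ rs ss d ∷ []

theorem4p8 : (ℝ : RealNumbers) → let open HMR ℝ in
    (concl : HS) (premises : List HS) → LogicalInstance concl premises →
    Der false concl → All (Der false) premises
theorem4p8 ℝ concl premises = Invertibility.invertible ℝ
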